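{- Let $\Gamma$ be a two-ended highly-arc-transitive digraph of prime out-valency $p$ such that $m>2$, where $m$ is the common cardinality of the fibres $\varphi^{ -1}(i)$, $i\in\mathbb Z$, of a surjective digraph homomorphism $\varphi:\Gamma\to\vec{\mathbb Z}$. Then $\Gamma$ is isomorphic to $\mathrm{Pl}^r(\Delta_p)$, where $r$ is such that $p^{r+1}=m$.
   Context: A digraph $\Gamma=(V\Gamma,E\Gamma)$ has vertex set $V\Gamma$ and arc set $E\Gamma\subseteq V\Gamma\times V\Gamma$. It is connected if its underlying undirected graph is connected. "Out-valency $p$" means that every vertex $v$ has exactly $p$ out-neighbours (vertices $u$ with $(v,u)\in E\Gamma$). A $k$-arc is a sequence of vertices $v_0,\dots,v_k$ with $(v_i,v_{i+1})\in E\Gamma$ for $0\le i<k$ (a 0-arc is a vertex). $\Gamma$ is highly-arc-transitive if $\mathrm{Aut}(\Gamma)$ is transitive on the $k$-arcs for all $k$. A ray is a one-way infinite path (in the underlying undirected graph) with distinct vertices. The ends of a digraph are the equivalence classes of rays, where two rays are equivalent if there is an infinite family of pairwise disjoint paths (ignoring directions) each having its initial vertex in one ray and terminal vertex in the other. A digraph is two-ended if it is connected and has exactly two ends. $\vec{\mathbb Z}$ is the digraph with vertex set $\mathbb Z$ and arcs $(i,i+1)$, $i\in\mathbb Z$; a digraph homomorphism is a map on vertices sending arcs to arcs (preserving direction). Every two-ended highly-arc-transitive digraph of positive out-valency admits a surjective digraph homomorphism $\varphi:\Gamma\to\vec{\mathbb Z}$, unique up to adding an integer constant, and its fibres are finite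 and all of the same size $m$. The partial line graph (line digraph) $\mathrm{Pl}(\Gamma)$ has the arcs of $\Gamma$ as vertices, and $((x,y),(w,z))$ is an arc of $\mathrm{Pl}(\Gamma)$ iff $y=w$. $\mathrm{Pl}^r(\Gamma)$ is obtained by applying this operation $r$ times successively ($\mathrm{Pl}^0(\Gamma)=\Gamma$). $\Delta_p$ is the digraph with vertex set $\mathbb Z\times\mathbb Z_p$ and arcs $((i,x),(i+1,y))$ for all $i\in\mathbb Z$ and $x,y\in\mathbb Z_p$. -}

module Defs where

open import Data.Fin.Base using (Fin; inject₁; fromℕ) renaming (zero to fzero; suc to fsuc)
open import Data.Integer.Base as ℤ using (ℤ)
open import Data.Nat.Base using (ℕ; zero; suc)
open import Data.Product.Base using (Σ; ∃; ∃₂; _×_; _,_)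
open import Function.Bundles using (_↔_; _⇔_; Inverse)
open import Function.Definitions using (Injective)
open import Level using (Level; _⊔_; 0ℓ) renaming (suc to lsuc)
open import Relation.Binary.Construct.Closure.Equivalence using (EqClosure)
open import Relation.Binary.Construct.Closure.Symmetric using (SymClosure)
open import Relation.Binary.Core using (Rel)
open import Relation.Binary.Definitions using (Irrelevant)
open import Relation.Binary.PropositionalEquality using (_≡_; _≢_)
open import Relation.Binary.PropositionalEquality.WithK using (≡-irrelevant)
open import Relation.Nullary.Negation using (¬_)

private
  variable
    a b c d : Level

-- E-irrelevant makes E a subset of V × V: there are no parallel arcs.
record Digraph (a b : Level) : Set (lsuc (a ⊔ b)) where
  field
    V            : Set a
    E            : Rel V b
    E-irrelevant : Irrelevant E

open Digraph using (V; E)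

Adjacent : (Γ : Digraph a b) → Rel (V Γ) b
Adjacent Γ = SymClosure (E Γ)

Connected : Digraph a b → Set (a ⊔ b)
Connected Γ = ∀ x y → EqClosure (E Γ) x y

OutValency : Digraph a b → ℕ → Set (a ⊔ b)
OutValency Γ p = ∀ v → ∃ (E Γ v) ↔ Fin p

IsHomomorphism : (Γ : Digraph a b) (Δ : Digraph c d) → (V Γ → V Δ) → Set (a ⊔ b ⊔ d)
IsHomomorphism Γ Δ φ = ∀ {x y} → E Γ x y → E Δ (φ x) (φ y)

infix 4 _≅_

record _≅_ (Γ : Digraph a b) (Δ : Digraph c d) : Set (a ⊔ b ⊔ c ⊔ d) where
  field
    vertices : V Γ ↔ V Δ

  open Inverse vertices public using (to; from)

  field
    arcs : ∀ {x y} → E Γ x y ⇔ E Δ (to x) (to y)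

Aut : Digraph a b → Set (a ⊔ b)
Aut Γ = Γ ≅ Γ

record KArc (Γ : Digraph a b) (k : ℕ) : Set (a ⊔ b) where
  field
    vertex : Fin (suc k) → V Γ
    arc    : ∀ (i : Fin k) → E Γ (vertex (inject₁ i)) (vertex (fsuc i))

HighlyArcTransitive : Digraph a b → Set (a ⊔ b)
HighlyArcTransitive Γ =
  ∀ k (α β : KArc Γ k) →
  Σ (Aut Γ) λ g → ∀ i → _≅_.to g (KArc.vertex α i) ≡ KArc.vertex β i

record Ray (Γ : Digraph a b) : Set (a ⊔ b) where
  field
    vertex   : ℕ → V Γ
    adjacent : ∀ n → Adjacent Γ (vertex n) (vertex (suc n))
    distinct : Injective _≡_ _≡_ vertex

record Path (Γ : Digraph a b) : Set (a ⊔ b) where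
  field
    length   : ℕ
    vertex   : Fin (suc length) → V Γ
    adjacent : ∀ (i : Fin length) → Adjacent Γ (vertex (inject₁ i)) (vertex (fsuc i))
    distinct : Injective _≡_ _≡_ vertex

  initial terminal : V Γ
  initial  = vertex fzero
  terminal = vertex (fromℕ length)

_∈ᴿ_ : {Γ : Digraph a b} → V Γ → Ray Γ → Set a
v ∈ᴿ R = ∃ λ n → Ray.vertex R n ≡ v

Disjoint : {Γ : Digraph a b} → Path Γ → Path Γ → Set a
Disjoint P Q = ∀ i j → Path.vertex P i ≢ Path.vertex Q j

SameEnd : {Γ : Digraph a b} → Ray Γ → Ray Γ → Set (a ⊔ b)
SameEnd {Γ = Γ} R S =
  Σ (ℕ → Path Γ) λ P →
    (∀ {i j} → i ≢ j → Disjoint (P i) (P j)) ×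
    (∀ i → Path.initial (P i) ∈ᴿ R × Path.terminal (P i) ∈ᴿ S)

-- "At most two ends" says that no ray is inequivalent to both R and S.
-- Demanding for every ray a decision as to which end it belongs to would be
-- classically the same, but not constructively provable even for Δ p below.
ExactlyTwoEnds : Digraph a b → Set (a ⊔ b)
ExactlyTwoEnds Γ =
  ∃₂ λ (R S : Ray Γ) →
    ¬ SameEnd R S ×
    (∀ (T : Ray Γ) → ¬ (¬ SameEnd T R × ¬ SameEnd T S))

TwoEnded : Digraph a b → Set (a ⊔ b)
TwoEnded Γ = Connected Γ × ExactlyTwoEnds Γ

ℤ⃗ : Digraph 0ℓ 0ℓ
ℤ⃗ = record
  { V            = ℤ
  ; E            = λ i j → j ≡ ℤ.suc i
  ; E-irrelevant = ≡-irrelevant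
  }

Fibre : {A : Set a} {B : Set b} → (A → B) → B → Set (a ⊔ b)
Fibre f y = ∃ λ x → f x ≡ y

Pl : Digraph a b → Digraph (a ⊔ b) a
Pl Γ = record
  { V            = ∃₂ (E Γ)
  ; E            = λ (_ , y , _) (w , _ , _) → y ≡ w
  ; E-irrelevant = ≡-irrelevant
  }

Pl^ : ℕ → Digraph a a → Digraph a a
Pl^ zero    Γ = Γ
Pl^ (suc r) Γ = Pl (Pl^ r Γ)

Δ : ℕ → Digraph 0ℓ 0ℓ
Δ p = record
  { V            = ℤ × Fin p
  ; E            = λ (i , _) (j , _) → j ≡ ℤ.suc i
  ; E-irrelevant = ≡-irrelevant
  }

module Submission where

-- Let A(z) and N(x) denote the sets of in- and out-neighbours. If A were injective, an
-- automorphism would be determined on all higher levels by its action on one level; but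
-- transitivity on k-arcs provides p ^ k automorphisms with different actions above a given
-- vertex, too many once p ^ k > m ^ m. So A(z) = A(w) for some z ≠ w, and as p is prime this
-- holds for any two vertices with a common in-neighbour: sets N(x), N(y) are equal or disjoint.
-- If m ≠ p, then vertices with a common in-neighbour have different out-neighbourhoods
-- (otherwise primality and connectedness force m = p). Identifying x and y when N(x) = N(y)
-- gives a digraph Γ′ with Γ ≅ Pl Γ′ which satisfies the same hypotheses with m / p in place
-- of m. The iteration stops at m = p, where Γ ≅ Δ p.

open import Defs
open import Algebra.Bundles using (AbelianGroup)
open import Data.Empty using (⊥-elim)
open import Data.Fin.Base as Fin using (Fin; finToFun; funToFin; fromℕ<; inject₁; combine) renaming (zero to fzero; suc to fsuc)
open import Data.Fin.Permutation using (↔⇒≡)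
import Data.Fin.Properties as Fin
open import Data.Integer.Base as ℤ using (ℤ; +_)
import Data.Integer.Properties as ℤ
open import Algebra.Properties.Group (AbelianGroup.group ℤ.+-0-abelianGroup) using () renaming (∙-cancelʳ to ℤ-+-cancelʳ; ∙-cancelˡ to ℤ-+-cancelˡ)
open import Data.Nat.Base as ℕ using (ℕ; zero; suc; _*_; _^_; _≤_; _<_; _>_; NonZero; z≤n; s≤s)
open import Data.Nat.Divisibility using (divides)
open import Data.Nat.Induction using (<-wellFounded)
open import Data.Nat.Primality using (Prime; prime⇒irreducible; prime⇒nonZero; prime⇒nonTrivial)
import Data.Nat.Properties as ℕ
open import Data.Product.Base using (Σ; ∃; ∃₂; _×_; _,_; proj₁; proj₂; map)
open import Data.Product.Function.Dependent.Propositional using (Σ-↔)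
open import Data.Sum.Base using (inj₁; inj₂)
open import Function.Base using (_∘_; id; const)
open import Function.Bundles using (_↔_; _⇔_; mk↔ₛ′; mk⇔; Inverse; Injection; Equivalence)
open import Function.Definitions using (Injective; Surjective)
import Function.Properties.Equivalence as ⇔
open import Function.Properties.Inverse using (↔-refl; ↔-sym; ↔-trans; ↔⇒↣)
open import Induction.WellFounded using (Acc; acc)
open import Level using (Level; _⊔_)
import Relation.Binary.Construct.Closure.Equivalence as EqClosure
open import Relation.Binary.Core using (Rel)
import Relation.Binary.Definitions as B
open import Relation.Binary.PropositionalEquality using (_≡_; _≢_; _≗_; refl; sym; trans; cong; cong₂; subst; subst₂; module ≡-Reasoning)
open import Relation.Binary.PropositionalEquality.WithK using (≡-irrelevant)
open import Relation.Binary.Structures using (IsEquivalence)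
open import Relation.Nullary.Decidable using (Dec; yes; no; map′; _×-dec_; _→-dec_; ¬?; decidable-stable)
open import Relation.Nullary.Irrelevant using (Irrelevant)
open import Relation.Nullary.Negation using (¬_; contradiction)
open import Relation.Unary using (Pred; Decidable)

private
  variable
    a b c d ℓ : Level

-- Finite sets: canonical representatives and counting.

↔-injective : ∀ {A : Set a} {B : Set b} (A↔B : A ↔ B) → Injective _≡_ _≡_ (Inverse.to A↔B)
↔-injective A↔B = Injection.injective (↔⇒↣ A↔B)

Least : ∀ {n} → Pred (Fin n) ℓ → Pred (Fin n) ℓ
Least P k = P k × (∀ j → P j → k Fin.≤ j)

least : ∀ {n} {P : Pred (Fin n) ℓ} → Decidable P → ∃ P → ∃ (Least P)
least {n = suc n} {P} P? (k , Pk) with P? fzero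
... | yes P0 = fzero , P0 , λ _ _ → z≤n
least P? (fzero  , Pk) | no ¬P0 = contradiction Pk ¬P0
least {P = P} P? (fsuc k , Pk) | no ¬P0 with least (P? ∘ fsuc) (k , Pk)
... | l , Pl , l≤ = fsuc l , Pl , minimal
  where
  minimal : ∀ j → P j → fsuc l Fin.≤ j
  minimal fzero    P0 = contradiction P0 ¬P0
  minimal (fsuc j) Pj = s≤s (l≤ j Pj)

-- Least elements serve as canonical class representatives, so that a quotient can be encoded as the
-- subtype of fixed points of `rep`.
module Representatives {n} {_~_ : Rel (Fin n) ℓ}
                       (isEquivalence : IsEquivalence _~_) (_~?_ : B.Decidable _~_) where
  open IsEquivalence isEquivalence renaming (refl to ~-refl; sym to ~-sym; trans to ~-trans)

  private
    least~ : ∀ k → ∃ (Least (k ~_))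
    least~ k = least (k ~?_) (k , ~-refl)

  abstract
    rep : Fin n → Fin n
    rep k = proj₁ (least~ k)

    ~-rep : ∀ k → k ~ rep k
    ~-rep k = proj₁ (proj₂ (least~ k))

    rep-cong : ∀ {k l} → k ~ l → rep k ≡ rep l
    rep-cong {k} {l} k~l = Fin.≤-antisym
      (proj₂ (proj₂ (least~ k)) _ (~-trans k~l (~-rep l)))
      (proj₂ (proj₂ (least~ l)) _ (~-trans (~-sym k~l) (~-rep k)))

    rep-reflects : ∀ {k l} → rep k ≡ rep l → k ~ l
    rep-reflects {k} {l} eq = ~-trans (~-rep k) (subst (_~ l) (sym eq) (~-sym (~-rep l)))

    rep-idem : ∀ k → rep (rep k) ≡ rep k
    rep-idem k = rep-cong (~-sym (~-rep k))

-- Irrelevance of `P` ensures that elements alone are counted, not proofs.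
Fin-subset : ∀ {n} {P : Pred (Fin n) ℓ} → Decidable P → (∀ k → Irrelevant (P k)) →
             ∃ λ s → Σ (Fin n) P ↔ Fin s
Fin-subset {n = zero}  P? irr = 0 , mk↔ₛ′ (λ ()) (λ ()) (λ ()) (λ ())
Fin-subset {n = suc n} {P} P? irr with P? fzero | Fin-subset (P? ∘ fsuc) (irr ∘ fsuc)
... | no ¬P0 | s , tail = s , ↔-trans drop tail
  where
  drop : Σ (Fin (suc n)) P ↔ Σ (Fin n) (P ∘ fsuc)
  drop = mk↔ₛ′ strengthen (map fsuc id) (λ _ → refl) inverse
    where
    strengthen : Σ (Fin (suc n)) P → Σ (Fin n) (P ∘ fsuc)
    strengthen (fzero  , P0) = contradiction P0 ¬P0
    strengthen (fsuc k , Pk) = k , Pk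
    inverse : ∀ x → map fsuc id (strengthen x) ≡ x
    inverse (fzero  , P0) = contradiction P0 ¬P0
    inverse (fsuc k , Pk) = refl
... | yes P0 | s , tail = suc s , mk↔ₛ′ to from to∘from from∘to
  where
  to : Σ (Fin (suc n)) P → Fin (suc s)
  to (fzero  , _ ) = fzero
  to (fsuc k , Pk) = fsuc (Inverse.to tail (k , Pk))
  from : Fin (suc s) → Σ (Fin (suc n)) P
  from fzero    = fzero , P0
  from (fsuc j) = map fsuc id (Inverse.from tail j)
  to∘from : ∀ j → to (from j) ≡ j
  to∘from fzero    = refl
  to∘from (fsuc j) = cong fsuc (Inverse.strictlyInverseˡ tail j)
  from∘to : ∀ x → from (to x) ≡ x
  from∘to (fzero  , P0′) = cong (fzero ,_) (irr fzero P0 P0′)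
  from∘to (fsuc k , Pk)  = cong (map fsuc id) (Inverse.strictlyInverseʳ tail (k , Pk))

abstract
  subset-↔-Fin : ∀ {A : Set a} {n} {P : Pred A ℓ} → A ↔ Fin n → Decidable P → (∀ x → Irrelevant (P x)) →
                 ∃ λ s → Σ A P ↔ Fin s
  subset-↔-Fin {P = P} A↔n P? irr with Fin-subset (P? ∘ Inverse.from A↔n) (irr ∘ Inverse.from A↔n)
  ... | s , P↔s = s , ↔-trans (↔-sym (Σ-↔ (↔-sym A↔n) ↔-refl)) P↔s

injection⇒≤ : ∀ {A : Set a} {B : Set b} {m n} → A ↔ Fin m → B ↔ Fin n →
              {f : A → B} → Injective _≡_ _≡_ f → m ≤ n
injection⇒≤ A↔m B↔n inj = Fin.injective⇒≤
  (↔-injective (↔-sym A↔m) ∘ inj ∘ ↔-injective B↔n)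

Fin-Σ-size : ∀ {A : Set a} {F : A → Set b} {m n k} →
             Fin k ↔ Σ A F → A ↔ Fin m → (∀ x → F x ↔ Fin n) → k ≡ m * n
Fin-Σ-size k↔ A↔m F↔n = ↔⇒≡ (↔-trans k↔ (↔-trans (Σ-↔ A↔m (F↔n _)) (↔-sym Fin.*↔×)))

-- The classes all have the same size, a divisor of p other than 1.
prime-block : ∀ {p} → Prime p → {_~_ : Rel (Fin p) ℓ} → IsEquivalence _~_ → B.Decidable _~_ →
  (∀ i j → ∃ λ (σ : Fin p → Fin p) → Injective _≡_ _≡_ σ × σ i ≡ j × (∀ {k l} → k ~ l → σ k ~ σ l)) →
  ∀ {i j} → i ≢ j → i ~ j → ∀ k l → k ~ l
prime-block {p = p} p-prime {_~_} isEquiv _~?_ homogeneous {i} {j} i≢j i~j k l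
  = rep-reflects (cong proj₁ (↔-injective canonical↔ {canon k} {canon l} (Fin1 count≡1 _ _)))
  where
  open Representatives isEquiv _~?_
  Canonical : Set
  Canonical = Σ (Fin p) λ r → rep r ≡ r
  canon : Fin p → Canonical
  canon k = rep k , rep-idem k
  Class : Fin p → Set
  Class r = Σ (Fin p) λ k → rep k ≡ r
  class-finite : ∀ r → ∃ λ s → Class r ↔ Fin s
  class-finite r = subset-↔-Fin ↔-refl (λ k → rep k Fin.≟ r) (λ _ → ≡-irrelevant)
  size : Fin p → ℕ
  size r = proj₁ (class-finite r)
  size-≤ : ∀ {r s} → rep r ≡ r → rep s ≡ s → size r ≤ size s
  -- `σ` preserves `_~_`, so it restricts to an injection from the class of `r` into the class of
  -- `s`.
  size-≤ {r} {s} r-can s-can with homogeneous r s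
  ... | σ , σ-inj , σr≡s , σ-cong = injection⇒≤ (proj₂ (class-finite r)) (proj₂ (class-finite s)) {f} f-inj
    where
    f : Class r → Class s
    f (k , e) = σ k , trans (rep-cong (subst (σ k ~_) σr≡s (σ-cong (rep-reflects (trans e (sym r-can)))))) s-can
    f-inj : Injective _≡_ _≡_ f
    f-inj {k , refl} {l , e} eq with refl ← σ-inj (cong proj₁ eq) = cong (k ,_) (≡-irrelevant refl e)
  class↔ : ∀ (r : Canonical) → Class (proj₁ r) ↔ Fin (size (rep i))
  class↔ (r , r-can) = subst (λ s → Class r ↔ Fin s)
    (ℕ.≤-antisym (size-≤ r-can (rep-idem i)) (size-≤ (rep-idem i) r-can)) (proj₂ (class-finite r))
  canonical-finite : ∃ λ n → Canonical ↔ Fin n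
  canonical-finite = subset-↔-Fin ↔-refl (λ k → rep k Fin.≟ k) (λ _ → ≡-irrelevant)
  count : ℕ
  count = proj₁ canonical-finite
  canonical↔ : Canonical ↔ Fin count
  canonical↔ = proj₂ canonical-finite
  split : Fin p ↔ Σ Canonical (Class ∘ proj₁)
  split = mk↔ₛ′ (λ k → canon k , k , refl) (λ (_ , k , _) → k)
    (λ { ((r , r-can) , k , refl) → cong (λ q → (_ , q) , k , refl) (≡-irrelevant _ _) }) (λ _ → refl)
  p≡count*size : p ≡ count * size (rep i)
  p≡count*size = Fin-Σ-size split canonical↔ class↔
  Fin1 : ∀ {n} → n ≡ 1 → (x y : Fin n) → x ≡ y
  Fin1 refl fzero fzero = refl
  size≢1 : size (rep i) ≢ 1
  size≢1 size≡1 = i≢j (cong proj₁ (↔-injective (proj₂ (class-finite (rep i)))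
    {i , refl} {j , sym (rep-cong i~j)} (Fin1 size≡1 _ _)))
  count≡1 : count ≡ 1
  -- The class of `i` also contains `j`, so its size, a divisor of `p`, can only be `p`.
  count≡1 with prime⇒irreducible p-prime (divides count p≡count*size)
  ... | inj₁ size≡1 = contradiction size≡1 size≢1
  ... | inj₂ size≡p = ℕ.*-cancelʳ-≡ count 1 p {{prime⇒nonZero p-prime}}
    (trans (cong (count *_) (sym size≡p)) (trans (sym p≡count*size) (sym (ℕ.*-identityˡ p))))

n<m^n : ∀ {m} → 1 < m → ∀ n → n < m ^ n
n<m^n 1<m zero    = ℕ.≤-refl
n<m^n {m} 1<m (suc n) = ℕ.≤-<-trans (n<m^n 1<m n) (ℕ.^-monoʳ-< m 1<m (ℕ.n<1+n n))

-- The maximum of finitely many thresholds works; it will give one number of steps after which a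
-- whole fibre has merged.
upper-bound : ∀ {n} (P : ℕ → Pred (Fin n) ℓ) → (∀ {s t j} → s ≤ t → P s j → P t j) →
              (∀ j → ∃ λ t → P t j) → ∃ λ t → ∀ j → P t j
upper-bound {n = zero}  P mono exists = 0 , λ ()
upper-bound {n = suc n} P mono exists with exists fzero | upper-bound (λ t → P t ∘ fsuc) mono (exists ∘ fsuc)
... | s , Ps | t , Pt = s ℕ.⊔ t , λ where
  fzero    → mono (ℕ.m≤m⊔n s t) Ps
  (fsuc j) → mono (ℕ.m≤n⊔m s t) (Pt j)

pointwise-⇔-isEquivalence : ∀ {A : Set a} {X : Set b} (F : A → X → Set c) →
                            IsEquivalence (λ x y → ∀ z → F x z ⇔ F y z)
pointwise-⇔-isEquivalence F = record
  { refl  = λ z → ⇔.refl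
  ; sym   = λ x~y z → ⇔.sym (x~y z)
  ; trans = λ x~y y~w z → ⇔.trans (x~y z) (y~w z)
  }

funToFin-cong : ∀ {m n} {f g : Fin m → Fin n} → f ≗ g → funToFin f ≡ funToFin g
funToFin-cong {zero}  f≗g = refl
funToFin-cong {suc m} f≗g = cong₂ combine (f≗g fzero) (funToFin-cong (f≗g ∘ fsuc))

ℤ-suc-injective : ∀ {i j} → ℤ.suc i ≡ ℤ.suc j → i ≡ j
ℤ-suc-injective {i} {j} eq = trans (sym (ℤ.pred-suc i)) (trans (cong ℤ.pred eq) (ℤ.pred-suc j))

-- Isomorphisms and line digraphs.

≅-sym : {Γ : Digraph a b} {Θ : Digraph c d} → Γ ≅ Θ → Θ ≅ Γ
≅-sym {Θ = Θ} g = record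
  { vertices = ↔-sym vertices
  ; arcs     = λ {x} {y} → mk⇔
      (λ e → Equivalence.from arcs (subst₂ (Digraph.E Θ) (sym (to∘from x)) (sym (to∘from y)) e))
      (λ e → subst₂ (Digraph.E Θ) (to∘from x) (to∘from y) (Equivalence.to arcs e))
  }
  where
  open _≅_ g
  to∘from : ∀ x → to (from x) ≡ x
  to∘from = Inverse.strictlyInverseˡ vertices

≅-trans : ∀ {e f} {Γ : Digraph a b} {Θ : Digraph c d} {Λ : Digraph e f} → Γ ≅ Θ → Θ ≅ Λ → Γ ≅ Λ
≅-trans g h = record
  { vertices = ↔-trans (_≅_.vertices g) (_≅_.vertices h)
  ; arcs     = ⇔.trans (_≅_.arcs g) (_≅_.arcs h)
  }

Pl-vertex-≡ : (Γ : Digraph a b) → let open Digraph Γ in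
              ∀ {x x′ y y′} {e : E x y} {e′ : E x′ y′} →
              x ≡ x′ → y ≡ y′ → _≡_ {A = ∃₂ E} (x , y , e) (x′ , y′ , e′)
Pl-vertex-≡ Γ refl refl = cong (λ e → _ , _ , e) (Digraph.E-irrelevant Γ _ _)

Pl-cong : {Γ : Digraph a b} {Θ : Digraph c d} → Γ ≅ Θ → Pl Γ ≅ Pl Θ
Pl-cong {Γ = Γ} {Θ = Θ} g = record
  { vertices = mk↔ₛ′
      (λ (x , y , e) → to x , to y , Equivalence.to arcs e)
      (λ (x , y , e) → from x , from y , Equivalence.to (_≅_.arcs (≅-sym g)) e)
      (λ _ → Pl-vertex-≡ Θ (Inverse.strictlyInverseˡ vertices _) (Inverse.strictlyInverseˡ vertices _))
      (λ _ → Pl-vertex-≡ Γ (Inverse.strictlyInverseʳ vertices _) (Inverse.strictlyInverseʳ vertices _))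
  ; arcs = mk⇔ (cong to) (↔-injective vertices)
  }
  where open _≅_ g

-- Layered digraphs: neighbours, levels, decidability.

-- The data that the induction passes from a digraph to its quotient; `m` is the decreasing
-- parameter.
record Layered {a b} (Γ : Digraph a b) (p m : ℕ) : Set (a ⊔ b) where
  open Digraph Γ
  field
    connected : Connected Γ
    hat       : HighlyArcTransitive Γ
    valency   : OutValency Γ p
    φ         : V → ℤ
    φ-hom     : IsHomomorphism Γ ℤ⃗ φ
    fibre     : ∀ i → Fibre φ i ↔ Fin m

module Structure {a b} {Γ : Digraph a b} {p m : ℕ} (L : Layered Γ p m) (p-prime : Prime p) .{{m≢0 : NonZero m}} where
  open Digraph Γ
  open Layered L
  open _≅_ using (to; from)

  nbr : V → Fin p → V
  nbr x k = proj₁ (Inverse.from (valency x) k)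

  nbr-E : ∀ x k → E x (nbr x k)
  nbr-E x k = proj₂ (Inverse.from (valency x) k)

  ∃E-≡ : ∀ {x} {z w : ∃ (E x)} → proj₁ z ≡ proj₁ w → z ≡ w
  ∃E-≡ refl = cong (_ ,_) (E-irrelevant _ _)

  nbr-injective : ∀ {x} → Injective _≡_ _≡_ (nbr x)
  nbr-injective {x} eq = ↔-injective (↔-sym (valency x)) (∃E-≡ eq)

  nbr-surjective : ∀ {x z} → E x z → ∃ λ k → nbr x k ≡ z
  nbr-surjective {x} {z} e = Inverse.to (valency x) (z , e) , cong proj₁ (Inverse.strictlyInverseʳ (valency x) (z , e))

  vtx : ∀ i → Fin m → V
  vtx i k = proj₁ (Inverse.from (fibre i) k)

  vtx-surjective : ∀ {i x} → φ x ≡ i → ∃ λ k → vtx i k ≡ x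
  vtx-surjective {i} {x} e = Inverse.to (fibre i) (x , e) , cong proj₁ (Inverse.strictlyInverseʳ (fibre i) (x , e))

  fibre-≡ : ∀ {i} {x y : Fibre φ i} → proj₁ x ≡ proj₁ y → x ≡ y
  fibre-≡ {x = x , _} refl = cong (x ,_) (≡-irrelevant _ _)

  infix 4 _≟_ _≈_ _≋_

  _≟_ : B.DecidableEquality V
  x ≟ y with φ x ℤ.≟ φ y
  ... | no  φx≢φy = no (φx≢φy ∘ cong φ)
  ... | yes φx≡φy = map′ (cong proj₁ ∘ ↔-injective (fibre (φ y))) (cong (Inverse.to (fibre (φ y))) ∘ fibre-≡)
                         (Inverse.to (fibre (φ y)) (x , φx≡φy) Fin.≟ Inverse.to (fibre (φ y)) (y , refl))

  E? : B.Decidable E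
  E? x y = map′ (λ (k , eq) → subst (E x) eq (nbr-E x k)) nbr-surjective (Fin.any? λ k → nbr x k ≟ y)

  first : Fin p
  first = fromℕ< (ℕ.>-nonZero⁻¹ p {{prime⇒nonZero p-prime}})

  child : V → V
  child x = nbr x first

  child-E : ∀ x → E x (child x)
  child-E x = nbr-E x first

  o : V
  o = vtx (+ 0) (fromℕ< (ℕ.>-nonZero⁻¹ m))

  to-hom : ∀ (g : Aut Γ) {x y} → E x y → E (to g x) (to g y)
  to-hom g = Equivalence.to (_≅_.arcs g)

  from∘to : ∀ (g : Aut Γ) x → from g (to g x) ≡ x
  from∘to g = Inverse.strictlyInverseʳ (_≅_.vertices g)

  to∘from : ∀ (g : Aut Γ) x → to g (from g x) ≡ x
  to∘from g = Inverse.strictlyInverseˡ (_≅_.vertices g)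

  to-injective : ∀ (g : Aut Γ) → Injective _≡_ _≡_ (to g)
  to-injective g = ↔-injective (_≅_.vertices g)

  arc-transitive : ∀ {x z y w} → E x z → E y w → ∃ λ g → to g x ≡ y × to g z ≡ w
  arc-transitive e f with hat 1 (arc e) (arc f)
    where
    arc : ∀ {x z} → E x z → KArc Γ 1
    arc {x} {z} e = record { vertex = λ { fzero → x ; (fsuc _) → z } ; arc = λ { fzero → e } }
  ... | g , eq = g , eq fzero , eq (fsuc fzero)

  -- The vertex `child o` has the in-neighbour `o`, and transitivity on 0-arcs carries it to any
  -- `z`.
  parent : ∀ z → ∃ λ y → E y z
  parent z with hat 0 (vertex (child o)) (vertex z)
    where
    vertex : V → KArc Γ 0
    vertex x = record { vertex = λ _ → x ; arc = λ () }
  ... | g , eq = to g o , subst (E _) (eq fzero) (to-hom g (child-E o))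

  -- Equal out-neighbourhoods and equal in-neighbourhoods.

  _≈_ : Rel V (a ⊔ b)
  x ≈ y = ∀ z → E x z ⇔ E y z

  _≋_ : Rel V (a ⊔ b)
  z ≋ w = ∀ y → E y z ⇔ E y w

  ≈-isEquivalence : IsEquivalence _≈_
  ≈-isEquivalence = pointwise-⇔-isEquivalence E

  ≋-isEquivalence : IsEquivalence _≋_
  ≋-isEquivalence = pointwise-⇔-isEquivalence (λ z y → E y z)

  ≈⇒φ≡ : ∀ {x y} → x ≈ y → φ x ≡ φ y
  ≈⇒φ≡ {x} x≈y = ℤ-suc-injective (trans (sym (φ-hom (child-E x))) (φ-hom (Equivalence.to (x≈y _) (child-E x))))

  Invariant : Rel V ℓ → Set (a ⊔ b ⊔ ℓ)
  Invariant _~_ = ∀ (g : Aut Γ) {x y} → x ~ y → to g x ~ to g y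

  E-adjointˡ : ∀ (g : Aut Γ) {x z} → E (to g x) z ⇔ E x (from g z)
  E-adjointˡ g {x} {z} = mk⇔
    (λ e → subst (λ x → E x (from g z)) (from∘to g x) (to-hom (≅-sym g) e))
    (λ e → subst (E (to g x)) (to∘from g z) (to-hom g e))

  E-adjointʳ : ∀ (g : Aut Γ) {y z} → E y (to g z) ⇔ E (from g y) z
  E-adjointʳ g {y} {z} = ⇔.sym (E-adjointˡ (≅-sym g))

  ≈-invariant : Invariant _≈_
  ≈-invariant g x≈y z = ⇔.trans (E-adjointˡ g) (⇔.trans (x≈y (from g z)) (⇔.sym (E-adjointˡ g)))

  ≋-invariant : Invariant _≋_
  ≋-invariant g z≋w y = ⇔.trans (E-adjointʳ g) (⇔.trans (z≋w (from g y)) (⇔.sym (E-adjointʳ g)))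

  -- In-neighbours of `z` all lie one level below `z`, so only the `m` vertices of one fibre need
  -- testing.
  _≋?_ : B.Decidable _≋_
  z ≋? w = map′ (λ (f , g) y → mk⇔ (f y) (g y))
                (λ z≋w → (λ y → Equivalence.to (z≋w y)) , (λ y → Equivalence.from (z≋w y)))
                (⊆-dec z w ×-dec ⊆-dec w z)
    where
    ⊆-dec : ∀ z w → Dec (∀ y → E y z → E y w)
    ⊆-dec z w = map′
      (λ f y e → let k , eq = vtx-surjective (trans (sym (ℤ.pred-suc (φ y))) (cong ℤ.pred (sym (φ-hom e))))
                 in subst (λ y → E y w) eq (f k (subst (λ y → E y z) (sym eq) e)))
      (λ f k → f _)
      (Fin.all? λ k → E? (vtx (ℤ.pred (φ z)) k) z →-dec E? (vtx (ℤ.pred (φ z)) k) w)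

  module _ {_~_ : Rel V ℓ} (~-isEquivalence : IsEquivalence _~_) (_~?_ : B.Decidable _~_)
           (~-invariant : Invariant _~_) where

    -- By `prime-block`, one nontrivial related pair among the `p` out-neighbours of `x` relates all
    -- of them; arc-transitivity then moves the conclusion to every `y`.
    siblings-~ : ∀ {x z z′} → E x z → E x z′ → z ≢ z′ → z ~ z′ →
                 ∀ {y w w′} → E y w → E y w′ → w ~ w′
    siblings-~ {x} {z} {z′} xz xz′ z≢z′ z~z′ {y} {w} {w′} yw yw′ with arc-transitive yw xz
    ... | g , gy≡x , gw≡z = subst₂ _~_ (from∘to g w) (from∘to g w′)
      (~-invariant (≅-sym g) (all-related (image yw) (image yw′)))
      where
      image : ∀ {v} → E y v → E x (to g v)
      image e = subst (λ x → E x _) gy≡x (to-hom g e)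

      homogeneous : ∀ i j → ∃ λ (σ : Fin p → Fin p) → Injective _≡_ _≡_ σ × σ i ≡ j ×
                    (∀ {k l} → nbr x k ~ nbr x l → nbr x (σ k) ~ nbr x (σ l))
      -- An automorphism carrying one arc out of `x` to another fixes `x`, hence permutes its
      -- out-neighbours; `σ` is this permutation on indices.
      homogeneous i j with arc-transitive (nbr-E x i) (nbr-E x j)
      ... | h , hx≡x , hi≡j = σ , σ-injective , nbr-injective (trans (nbr-σ i) hi≡j) ,
                              λ {k} {l} k~l → subst₂ _~_ (sym (nbr-σ k)) (sym (nbr-σ l)) (~-invariant h k~l)
        where
        lift : ∀ k → ∃ λ l → nbr x l ≡ to h (nbr x k)
        lift k = nbr-surjective (subst (λ y → E y (to h (nbr x k))) hx≡x (to-hom h (nbr-E x k)))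
        σ : Fin p → Fin p
        σ k = proj₁ (lift k)
        nbr-σ : ∀ k → nbr x (σ k) ≡ to h (nbr x k)
        nbr-σ k = proj₂ (lift k)
        σ-injective : Injective _≡_ _≡_ σ
        σ-injective {k} {l} eq = nbr-injective (to-injective h (trans (sym (nbr-σ k)) (trans (cong (nbr x) eq) (nbr-σ l))))

      all-related : ∀ {v v′} → E x v → E x v′ → v ~ v′
      all-related xv xv′ with nbr-surjective xz | nbr-surjective xz′ | nbr-surjective xv | nbr-surjective xv′
      ... | i , refl | j , refl | k , refl | l , refl = prime-block p-prime
        (record { refl = ~-refl ; sym = ~-sym ; trans = ~-trans })
        (λ k l → nbr x k ~? nbr x l) homogeneous (z≢z′ ∘ cong (nbr x)) z~z′ k l
        where open IsEquivalence ~-isEquivalence using () renaming (refl to ~-refl; sym to ~-sym; trans to ~-trans)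

  -- Counting arcs from a base vertex.

  -- Words over `Fin p` code the `k`-arcs starting at `x`, so there are `p ^ k` of them.
  walk : V → ∀ {k} → (Fin k → Fin p) → Fin (suc k) → V
  walk x w fzero = x
  walk x {suc k} w (fsuc j) = walk (nbr x (w fzero)) (w ∘ fsuc) j

  walk-E : ∀ x {k} (w : Fin k → Fin p) j → E (walk x w (inject₁ j)) (walk x w (fsuc j))
  walk-E x w fzero    = nbr-E x (w fzero)
  walk-E x w (fsuc j) = walk-E (nbr x (w fzero)) (w ∘ fsuc) j

  walk-injective : ∀ {x y k} {v w : Fin k → Fin p} → walk x v ≗ walk y w → v ≗ w
  walk-injective {x} {v = v} {w} eq fzero =
    nbr-injective (trans (eq (fsuc fzero)) (cong (λ z → nbr z (w fzero)) (sym (eq fzero))))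
  walk-injective eq (fsuc j) = walk-injective (eq ∘ fsuc) j

  -- Whether `g` keeps the level of a vertex is the same at both ends of an arc, and connectedness
  -- spreads it from `o`.
  fixing-preserves-φ : ∀ (g : Aut Γ) → to g o ≡ o → ∀ x → φ (to g x) ≡ φ x
  fixing-preserves-φ g go≡o x = Equivalence.to (EqClosure.fold ⇔-equivalence step (connected o x)) (cong φ go≡o)
    where
    Preserved : V → Set
    Preserved x = φ (to g x) ≡ φ x
    ⇔-equivalence : IsEquivalence (λ x y → Preserved x ⇔ Preserved y)
    ⇔-equivalence = record { refl = ⇔.refl ; sym = ⇔.sym ; trans = ⇔.trans }
    step : ∀ {x y} → E x y → Preserved x ⇔ Preserved y
    step e = mk⇔
      (λ eq → trans (φ-hom (to-hom g e)) (trans (cong ℤ.suc eq) (sym (φ-hom e))))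
      (λ eq → ℤ-suc-injective (trans (sym (φ-hom (to-hom g e))) (trans eq (φ-hom e))))

  ≋-not-discrete : ¬ (∀ {z w} → z ≋ w → z ≡ w)
  ≋-not-discrete ≋⇒≡ =
    let i , j , i<j , eq = Fin.pigeonhole (n<m^n (ℕ.nonTrivial⇒n>1 p {{prime⇒nonTrivial p-prime}}) k) (funToFin ∘ action)
    in Fin.<⇒≢ i<j (action-injective i j eq)
    where
    -- The number of self-maps of a fibre doubles as the length of the arcs: since `k < p ^ k`, two
    -- of the automorphisms below act equally on the fibre of `o`.
    k : ℕ
    k = m ^ m

    arc : (Fin k → Fin p) → KArc Γ k
    arc w = record { vertex = walk o w ; arc = walk-E o w }

    -- One reference arc is carried to the arc of each word `w`; all these automorphisms fix `o`, so
    -- they permute its fibre.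
    aut : ∀ w → Σ (Aut Γ) λ g → ∀ j → to g (walk o (const first) j) ≡ walk o w j
    aut w = hat k (arc (const first)) (arc w)

    g : Fin (p ^ k) → Aut Γ
    g i = proj₁ (aut (finToFun i))

    g-walk : ∀ i j → to (g i) (walk o (const first) j) ≡ walk o (finToFun i) j
    g-walk i = proj₂ (aut (finToFun i))

    image : ∀ i {x} → φ x ≡ φ o → Fibre φ (φ o)
    image i {x} φx≡φo = to (g i) x , trans (fixing-preserves-φ (g i) (g-walk i fzero) x) φx≡φo

    action : Fin (p ^ k) → Fin m → Fin m
    action i l = Inverse.to (fibre (φ o)) (image i (proj₂ (Inverse.from (fibre (φ o)) l)))

    Agree : Fin (p ^ k) → Fin (p ^ k) → ℤ → Set a
    Agree i j n = ∀ x → φ x ≡ n → to (g i) x ≡ to (g j) x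

    agree-o : ∀ i j → funToFin (action i) ≡ funToFin (action j) → Agree i j (φ o)
    agree-o i j eq x φx≡φo with vtx-surjective φx≡φo
    ... | l , refl = cong proj₁ (↔-injective (fibre (φ o)) (begin
      action i l                        ≡⟨ Fin.finToFun-funToFin (action i) l ⟨
      finToFun (funToFin (action i)) l  ≡⟨ cong (λ c → finToFun c l) eq ⟩
      finToFun (funToFin (action j)) l  ≡⟨ Fin.finToFun-funToFin (action j) l ⟩
      action j l                        ∎))
      where open ≡-Reasoning

    -- In-neighbours of a vertex on level `n + 1` lie on level `n`, where the automorphisms agree;
    -- its two images thus have the same in-neighbours and coincide by assumption.
    agree-suc : ∀ i j {n} → Agree i j n → Agree i j (ℤ.suc n)
    agree-suc i j {n} agree x φx≡1+n = ≋⇒≡ λ y → mk⇔ (transfer i j agree) (transfer j i λ x e → sym (agree x e))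
      where
      transfer : ∀ i j → Agree i j n → ∀ {y} → E y (to (g i) x) → E y (to (g j) x)
      transfer i j agree {y} e = subst (λ y → E y (to (g j) x)) (trans (sym (agree _ level)) (to∘from (g i) y)) (to-hom (g j) e′)
        where
        e′ : E (from (g i) y) x
        e′ = Equivalence.to (E-adjointʳ (g i)) e
        level : φ (from (g i) y) ≡ n
        level = ℤ-suc-injective (trans (sym (φ-hom e′)) φx≡1+n)

    agree-walk : ∀ i j x {l} (w : Fin l → Fin p) → Agree i j (φ x) → ∀ t → to (g i) (walk x w t) ≡ to (g j) (walk x w t)
    agree-walk i j x w agree fzero = agree x refl
    agree-walk i j x {suc l} w agree (fsuc t) = agree-walk i j (nbr x (w fzero)) (w ∘ fsuc)
      (subst (Agree i j) (sym (φ-hom (nbr-E x (w fzero)))) (agree-suc i j agree)) t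

    -- Agreement on the level of `o` climbs along the reference arc, so both automorphisms send it
    -- to the same arc, and the two words are equal.
    action-injective : ∀ i j → funToFin (action i) ≡ funToFin (action j) → i ≡ j
    action-injective i j eq = trans (sym (Fin.funToFin-finToFin {k} {p} i)) (trans
      (funToFin-cong (walk-injective λ t → trans (sym (g-walk i t))
        (trans (agree-walk i j o (const first) (agree-o i j eq) t) (g-walk j t))))
      (Fin.funToFin-finToFin {k} {p} j))

  -- Neighbourhoods of siblings, that is, of vertices with a common in-neighbour.

  -- If some other out-neighbour of `o` is related to `child o`, then `siblings-~` applies; if none
  -- is, `_≋_` is discrete, which `≋-not-discrete` excludes.
  siblings-≋ : ∀ {y z w} → E y z → E y w → z ≋ w
  siblings-≋ with Fin.any? (λ k → ¬? (nbr o k ≟ child o) ×-dec (child o ≋? nbr o k))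
  ... | yes (k , k≢ , child≋) = siblings-~ ≋-isEquivalence _≋?_ ≋-invariant
    (child-E o) (nbr-E o k) (k≢ ∘ sym) child≋
  ... | no ∄ = ⊥-elim (≋-not-discrete discrete)
    where
    discrete : ∀ {z w} → z ≋ w → z ≡ w
    discrete {z} {w} z≋w with parent z
    -- Related vertices share the in-neighbour `y`; moving `y` to `o` and `z` to `child o` turns `w`
    -- into an out-neighbour of `o` related to `child o`.
    ... | y , yz with arc-transitive yz (child-E o)
    ...   | g , gy≡o , gz≡child with nbr-surjective {o} {to g w}
              (subst (λ y → E y (to g w)) gy≡o (to-hom g (Equivalence.to (z≋w y) yz)))
    ...     | k , k≡gw = to-injective g (trans gz≡child (decidable-stable (child o ≟ to g w) λ ≢gw →
      ∄ (k , (λ eq → ≢gw (trans (sym eq) k≡gw)) , subst₂ _≋_ gz≡child (sym k≡gw) (≋-invariant g z≋w))))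

  -- Any other out-neighbour `w` of `x` is a sibling of `z`, so it has the same in-neighbours, `y`
  -- among them.
  common-child⇒≈ : ∀ {x y z} → E x z → E y z → x ≈ y
  common-child⇒≈ xz yz w = mk⇔
    (λ xw → Equivalence.to (siblings-≋ xz xw _) yz)
    (λ yw → Equivalence.to (siblings-≋ yz yw _) xz)

  -- Out-neighbourhoods are equal or disjoint, so testing a single arc suffices.
  _≈?_ : B.Decidable _≈_
  x ≈? y = map′ (common-child⇒≈ (child-E x)) (λ x≈y → Equivalence.to (x≈y _) (child-E x)) (E? y (child x))

  open IsEquivalence ≈-isEquivalence using ()
    renaming (refl to ≈-refl; sym to ≈-sym; trans to ≈-trans; reflexive to ≈-reflexive)

  p≤m : p ≤ m
  p≤m = injection⇒≤ (valency o) (fibre _) {λ (z , e) → z , φ-hom e} λ eq → ∃E-≡ (cong proj₁ eq)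

  -- The case in which siblings have equal out-neighbourhoods.

  descend : ℕ → V → V
  descend zero    x = x
  descend (suc n) x = child (descend n x)

  φ-descend : ∀ n x → φ (descend n x) ≡ + n ℤ.+ φ x
  φ-descend zero    x = sym (ℤ.+-identityˡ _)
  φ-descend (suc n) x = trans (φ-hom (child-E (descend n x))) (trans (cong ℤ.suc (φ-descend n x)) (sym (ℤ.suc-+ n (φ x))))

  descend-+ : ∀ s t x → descend s (descend t x) ≡ descend (s ℕ.+ t) x
  descend-+ zero    t x = refl
  descend-+ (suc s) t x = cong child (descend-+ s t x)

  -- Up to `_≈_` every vertex now has a single child, so following children makes the vertices of a
  -- level merge.
  module Collapsed (siblings-≈ : ∀ {x z w} → E x z → E x w → z ≈ w) where

    descend-cong : ∀ n {x y} → x ≈ y → descend n x ≈ descend n y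
    descend-cong zero    x≈y = x≈y
    descend-cong (suc n) x≈y = siblings-≈ (child-E _) (Equivalence.from (descend-cong n x≈y _) (child-E _))

    Merge : Rel V (a ⊔ b)
    Merge x y = ∃₂ λ s t → descend s x ≈ descend t y

    merge : ∀ x y → Merge x y
    -- For an arc from `x` to `y`, one step from `x` gives a sibling of `y`.
    merge x y = EqClosure.fold merge-isEquivalence (λ {x} e → 1 , 0 , siblings-≈ (child-E x) e) (connected x y)
      where
      merge-trans : ∀ {x y z} → Merge x y → Merge y z → Merge x z
      merge-trans {x} {y} {z} (s , t , x≈y) (s′ , t′ , y≈z) = s′ ℕ.+ s , t ℕ.+ t′ ,
        ≈-trans (≈-reflexive (sym (descend-+ s′ s x))) (≈-trans (descend-cong s′ x≈y)
          (≈-trans (≈-reflexive swap)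
            (≈-trans (descend-cong t y≈z) (≈-reflexive (descend-+ t t′ z)))))
        where
        swap : descend s′ (descend t y) ≡ descend t (descend s′ y)
        swap = trans (descend-+ s′ t y)
          (trans (cong (λ n → descend n y) (ℕ.+-comm s′ t)) (sym (descend-+ t s′ y)))

      merge-isEquivalence : IsEquivalence Merge
      merge-isEquivalence = record
        { refl  = 0 , 0 , ≈-refl
        ; sym   = λ (s , t , eq) → t , s , ≈-sym eq
        ; trans = merge-trans
        }

    -- Equivalent vertices lie on one level, which forces the two numbers of steps to agree.
    merge-level : ∀ x → φ x ≡ φ o → ∃ λ t → descend t x ≈ descend t o
    merge-level x φx≡φo = let s , t , eq = merge x o in
      s , subst (λ t → descend s x ≈ descend t o) (sym (equal-length s t eq)) eq
      where
      open ≡-Reasoning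
      equal-length : ∀ s t → descend s x ≈ descend t o → s ≡ t
      equal-length s t eq = ℤ.+-injective (ℤ-+-cancelʳ (φ o) (+ s) (+ t) (begin
        + s ℤ.+ φ o      ≡⟨ cong (λ i → + s ℤ.+ i) φx≡φo ⟨
        + s ℤ.+ φ x      ≡⟨ φ-descend s x ⟨
        φ (descend s x)  ≡⟨ ≈⇒φ≡ eq ⟩
        φ (descend t o)  ≡⟨ φ-descend t o ⟩
        + t ℤ.+ φ o      ∎))

    -- A parent `y′` of `y` is a sibling of `child (descend n x)`, so both have `y` as
    -- out-neighbour.
    ancestor : ∀ n y → ∃ λ x → E (descend n x) y
    ancestor zero    y = parent y
    ancestor (suc n) y with parent y
    ... | y′ , y′y with ancestor n y′
    ...   | x , xy′ = x , Equivalence.to (siblings-≈ xy′ (child-E _) y) y′y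

    -- After some `t` steps the whole fibre of `o` has merged. Every vertex one level above
    -- `descend t o` has an ancestor in that fibre, hence is an out-neighbour of `descend t o`; this
    -- gives `m ≤ p`.
    m≡p : m ≡ p
    m≡p with upper-bound (λ t k → descend t (vtx (φ o) k) ≈ descend t o) monotone
               (λ k → merge-level _ (proj₂ (Inverse.from (fibre (φ o)) k)))
      where
      monotone : ∀ {s t k} → s ≤ t → descend s (vtx (φ o) k) ≈ descend s o → descend t (vtx (φ o) k) ≈ descend t o
      monotone {s} {t} {k} s≤t eq = subst (λ t → descend t (vtx (φ o) k) ≈ descend t o) (ℕ.m∸n+n≡m s≤t)
        (≈-trans (≈-reflexive (sym (descend-+ (t ℕ.∸ s) s _)))
          (≈-trans (descend-cong (t ℕ.∸ s) eq) (≈-reflexive (descend-+ (t ℕ.∸ s) s _))))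
    ... | t , merged = ℕ.≤-antisym (injection⇒≤ (fibre (ℤ.suc (φ (descend t o)))) (valency (descend t o)) {f} f-injective) p≤m
      where
      reach : ∀ {y} → φ y ≡ ℤ.suc (φ (descend t o)) → E (descend t o) y
      reach {y} φy with ancestor t y
      ... | x , xy with vtx-surjective {φ o} {x} (ℤ-+-cancelˡ (+ t) (φ x) (φ o)
                          (trans (sym (φ-descend t x))
                            (trans (ℤ-suc-injective (trans (sym (φ-hom xy)) φy)) (φ-descend t o))))
      ...   | k , refl = Equivalence.to (merged k y) xy
      f : Fibre φ (ℤ.suc (φ (descend t o))) → ∃ (E (descend t o))
      f (y , φy) = y , reach φy
      f-injective : Injective _≡_ _≡_ f
      f-injective eq = fibre-≡ (cong proj₁ eq)

  -- Fibres of size `p`.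

  ≅Δ : m ≡ p → Γ ≅ Δ p
  ≅Δ refl = record
    { vertices = ↔-trans by-level (Σ-↔ ↔-refl (fibre _))
    ; arcs     = mk⇔ φ-hom complete
    }
    where
    by-level : V ↔ Σ ℤ (Fibre φ)
    by-level = mk↔ₛ′ (λ x → φ x , x , refl) (λ (_ , x , _) → x) (λ { (_ , x , refl) → refl }) (λ _ → refl)
    complete : ∀ {x y} → φ y ≡ ℤ.suc (φ x) → E x y
    complete {x} {y} φy = decidable-stable (E? x y) λ ¬xy →
      ℕ.<-irrefl refl (injection⇒≤ ↔-refl (fibre (ℤ.suc (φ x))) (f-injective ¬xy))
      where
      -- A missing arc to `y` would put `p + 1` distinct vertices into a fibre of size `p`: `y` and
      -- the `p` out-neighbours of `x`.
      f : Fin (suc p) → Fibre φ (ℤ.suc (φ x))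
      f fzero    = y , φy
      f (fsuc k) = nbr x k , φ-hom (nbr-E x k)
      f-injective : ¬ E x y → Injective _≡_ _≡_ f
      f-injective ¬xy {fzero}  {fzero}  eq = refl
      f-injective ¬xy {fzero}  {fsuc l} eq = contradiction (subst (E x) (sym (cong proj₁ eq)) (nbr-E x l)) ¬xy
      f-injective ¬xy {fsuc k} {fzero}  eq = contradiction (subst (E x) (cong proj₁ eq) (nbr-E x k)) ¬xy
      f-injective ¬xy {fsuc k} {fsuc l} eq = cong fsuc (nbr-injective (cong proj₁ eq))

  -- The quotient by equality of out-neighbourhoods.

  -- Two distinct equivalent siblings would make all siblings equivalent by `siblings-~`, which is
  -- the collapsed case.
  siblings-≈⇒≡ : m ≢ p → ∀ {x z w} → E x z → E x w → z ≈ w → z ≡ w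
  siblings-≈⇒≡ m≢p {z = z} {w} xz xw z≈w = decidable-stable (z ≟ w) λ z≢w →
    m≢p (Collapsed.m≡p (siblings-~ ≈-isEquivalence _≈?_ ≈-invariant xz xw z≢w z≈w))

  module Quotient (siblings-≈⇒≡ : ∀ {x z w} → E x z → E x w → z ≈ w → z ≡ w) where

    _≈[_]_ : Fin m → ℤ → Fin m → Set (a ⊔ b)
    k ≈[ i ] l = vtx i k ≈ vtx i l

    ≈[]-isEquivalence : ∀ i → IsEquivalence (_≈[ i ]_)
    ≈[]-isEquivalence i = record { refl = ≈-refl ; sym = ≈-sym ; trans = ≈-trans }

    _≈[_]?_ : ∀ k i l → Dec (k ≈[ i ] l)
    k ≈[ i ]? l = vtx i k ≈? vtx i l

    -- Equivalent vertices share a level, so representatives can be chosen in each fibre separately.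
    module Rep (i : ℤ) = Representatives (≈[]-isEquivalence i) (_≈[ i ]?_)

    rep-at : ∀ i → Fibre φ i → V
    rep-at i x = vtx i (Rep.rep i (Inverse.to (fibre i) x))

    abstract
      rep : V → V
      rep x = rep-at (φ x) (x , refl)

      rep-at-≡ : ∀ {i} (x : Fibre φ i) → rep (proj₁ x) ≡ rep-at i x
      rep-at-≡ (x , refl) = refl

      vtx-to : ∀ {i} (x : Fibre φ i) → vtx i (Inverse.to (fibre i) x) ≡ proj₁ x
      vtx-to {i} x = cong proj₁ (Inverse.strictlyInverseʳ (fibre i) x)

      ≈-rep : ∀ x → x ≈ rep x
      ≈-rep x = ≈-trans (≈-reflexive (sym (vtx-to (x , refl)))) (Rep.~-rep (φ x) _)

      rep-cong : ∀ {x y} → x ≈ y → rep x ≡ rep y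
      rep-cong {x} {y} x≈y = trans (cong (vtx (φ x)) (Rep.rep-cong (φ x)
        (≈-trans (≈-reflexive (vtx-to (x , refl))) (≈-trans x≈y (≈-reflexive (sym (vtx-to y′)))))))
        (sym (rep-at-≡ y′))
        where
        y′ : Fibre φ (φ x)
        y′ = y , sym (≈⇒φ≡ x≈y)

      rep-reflects : ∀ {x y} → rep x ≡ rep y → x ≈ y
      rep-reflects {x} {y} eq = ≈-trans (≈-rep x) (≈-trans (≈-reflexive eq) (≈-sym (≈-rep y)))

    -- Classes are encoded as fixed points of `rep`. An arc stores a vertex `z` of `Γ` in the target
    -- class; as distinct siblings are inequivalent, `z` is unique, so there are no parallel arcs.
    Γ/≈ : Digraph a (a ⊔ b)
    Γ/≈ = record
      { V            = Σ V λ x → rep x ≡ x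
      ; E            = λ (x , _) (y , _) → Σ V λ z → E x z × rep z ≡ y
      ; E-irrelevant = irrelevant
      }
      where
      irrelevant : ∀ {x y} (e f : Σ V λ z → E x z × rep z ≡ y) → e ≡ f
      irrelevant (z , xz , z≈y) (w , xw , w≈y) with refl ← siblings-≈⇒≡ xz xw (rep-reflects (trans z≈y (sym w≈y))) =
        cong₂ (λ e q → z , e , q) (E-irrelevant xz xw) (≡-irrelevant z≈y w≈y)

    open Digraph Γ/≈ using () renaming (V to V/≈; E to E/≈)

    V/≈-≡ : {x y : V/≈} → proj₁ x ≡ proj₁ y → x ≡ y
    V/≈-≡ {x , _} refl = cong (x ,_) (≡-irrelevant _ _)

    π : V → V/≈
    π x = rep x , rep-cong (≈-sym (≈-rep x))

    π-cong : ∀ {x y} → x ≈ y → π x ≡ π y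
    π-cong x≈y = V/≈-≡ (rep-cong x≈y)

    π-proj₁ : ∀ x → π (proj₁ x) ≡ x
    π-proj₁ (x , rep-x≡x) = V/≈-≡ rep-x≡x

    π-hom : ∀ {x y} → E x y → E/≈ (π x) (π y)
    π-hom {x} {y} e = y , Equivalence.to (≈-rep x y) e , refl

    -- By `common-child⇒≈` the in-neighbours of `z` form exactly one class, so the choice of parent
    -- does not matter.
    in-class : V → V/≈
    in-class z = π (proj₁ (parent z))

    in-class-E : ∀ z → E (proj₁ (in-class z)) z
    in-class-E z = Equivalence.to (≈-rep _ z) (proj₂ (parent z))

    in-class-unique : ∀ (x : V/≈) {z} → E (proj₁ x) z → in-class z ≡ x
    in-class-unique x xz = trans (π-cong (common-child⇒≈ (proj₂ (parent _)) xz)) (π-proj₁ x)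

    -- A vertex `z` becomes the arc from the class of its in-neighbours to its own class;
    -- conversely, each arc of the quotient stores its `z`.
    ≅Pl : Γ ≅ Pl Γ/≈
    ≅Pl = record
      { vertices = mk↔ₛ′ (λ z → in-class z , π z , z , in-class-E z , refl) (λ (_ , _ , z , _) → z)
          (λ (x , _ , _ , xz , rep≡) → Pl-vertex-≡ Γ/≈ (in-class-unique x xz) (V/≈-≡ rep≡))
          (λ _ → refl)
      ; arcs = λ {z} {w} → mk⇔
          (λ zw → sym (in-class-unique (π z) (Equivalence.to (≈-rep z w) zw)))
          (λ eq → Equivalence.from (rep-reflects (cong proj₁ eq) w) (proj₂ (parent w)))
      }

    -- The hypotheses pass to the quotient.

    connected/≈ : Connected Γ/≈
    connected/≈ x y = subst₂ (EqClosure.EqClosure E/≈) (π-proj₁ x) (π-proj₁ y)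
      (EqClosure.gmap {R = E} {S = E/≈} π (λ {x} {y} → π-hom {x} {y}) (connected (proj₁ x) (proj₁ y)))

    valency/≈ : OutValency Γ/≈ p
    valency/≈ x = ↔-trans (mk↔ₛ′ (λ (_ , z , xz , _) → z , xz) from-nbr (λ _ → refl) inverse) (valency (proj₁ x))
      where
      from-nbr : ∃ (E (proj₁ x)) → ∃ (E/≈ x)
      from-nbr (z , xz) = π z , z , xz , refl
      inverse : ∀ ((y , z , xz , rep≡) : ∃ (E/≈ x)) → from-nbr (z , xz) ≡ (y , z , xz , rep≡)
      inverse ((y , y-can) , z , xz , refl) = cong (λ q → (y , q) , z , xz , refl) (≡-irrelevant _ _)

    φ/≈ : V/≈ → ℤ
    φ/≈ = φ ∘ proj₁

    φ-rep : ∀ x → φ (rep x) ≡ φ x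
    φ-rep x = sym (≈⇒φ≡ (≈-rep x))

    φ/≈-hom : IsHomomorphism Γ/≈ ℤ⃗ φ/≈
    φ/≈-hom (z , xz , refl) = trans (φ-rep z) (φ-hom xz)

    abstract
      fibre/≈-finite : ∀ i → ∃ λ n → Fibre φ/≈ i ↔ Fin n
      fibre/≈-finite i = map id (↔-trans swap) (subset-↔-Fin (fibre i) (λ x → rep (proj₁ x) ≟ proj₁ x) (λ _ → ≡-irrelevant))
        where
        swap : Fibre φ/≈ i ↔ Σ (Fibre φ i) λ x → rep (proj₁ x) ≡ proj₁ x
        swap = mk↔ₛ′ (λ ((x , q) , r) → (x , r) , q) (λ ((x , r) , q) → (x , q) , r) (λ _ → refl) (λ _ → refl)

    -- Each vertex on level `i + 1` is an out-neighbour of exactly one class on level `i`, and each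
    -- class has `p` out-neighbours.
    m≡size*p : ∀ i → m ≡ proj₁ (fibre/≈-finite i) * p
    m≡size*p i = Fin-Σ-size (↔-trans (↔-sym (fibre (ℤ.suc i))) by-in-class)
      (proj₂ (fibre/≈-finite i)) (λ x → valency (proj₁ (proj₁ x)))
      where
      level : ∀ {z} → φ z ≡ ℤ.suc i → φ/≈ (in-class z) ≡ i
      level {z} φz = ℤ-suc-injective (trans (sym (φ-hom (in-class-E z))) φz)
      ≡-from : ∀ {x y : V/≈} (eq : x ≡ y) {q : φ/≈ x ≡ i} {r : φ/≈ y ≡ i}
               {z} {e : E (proj₁ x) z} {f : E (proj₁ y) z} →
               _≡_ {A = Σ (Fibre φ/≈ i) λ x → ∃ (E (proj₁ (proj₁ x)))} ((x , q) , z , e) ((y , r) , z , f)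
      ≡-from refl {q} {r} {z} {e} {f} = cong₂ (λ q e → (_ , q) , z , e) (≡-irrelevant q r) (E-irrelevant e f)
      by-in-class : Fibre φ (ℤ.suc i) ↔ Σ (Fibre φ/≈ i) λ x → ∃ (E (proj₁ (proj₁ x)))
      by-in-class = mk↔ₛ′
        (λ (z , φz) → (in-class z , level φz) , z , in-class-E z)
        (λ ((x , φx) , z , xz) → z , trans (φ-hom xz) (cong ℤ.suc φx))
        (λ ((x , _) , _ , xz) → ≡-from (in-class-unique x xz))
        (λ _ → fibre-≡ refl)

    m/≈ : ℕ
    m/≈ = proj₁ (fibre/≈-finite (+ 0))

    -- Every fibre size multiplied by `p` gives `m`, so all agree with the one at level 0.
    fibre/≈ : ∀ i → Fibre φ/≈ i ↔ Fin m/≈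
    fibre/≈ i = subst (λ n → Fibre φ/≈ i ↔ Fin n)
      (ℕ.*-cancelʳ-≡ _ _ p {{prime⇒nonZero p-prime}} (trans (sym (m≡size*p i)) (m≡size*p (+ 0))))
      (proj₂ (fibre/≈-finite i))

    π-Aut : Aut Γ → V/≈ → V/≈
    π-Aut g x = π (to g (proj₁ x))

    π-Aut-π : ∀ g x → π-Aut g (π x) ≡ π (to g x)
    π-Aut-π g x = π-cong (≈-invariant g (≈-sym (≈-rep x)))

    π-Aut-inverse : ∀ g h → (∀ x → to g (to h x) ≡ x) → ∀ x → π-Aut g (π-Aut h x) ≡ x
    π-Aut-inverse g h inverse x = trans (π-Aut-π g _) (trans (cong π (inverse (proj₁ x))) (π-proj₁ x))

    π-Aut-hom : ∀ g {x y} → E/≈ x y → E/≈ (π-Aut g x) (π-Aut g y)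
    π-Aut-hom g {x} {y} (z , xz , rep≡) = subst (E/≈ (π-Aut g x))
      (trans (sym (π-Aut-π g z)) (cong (π-Aut g) (V/≈-≡ {π z} {y} rep≡))) (π-hom (to-hom g xz))

    Aut/≈ : Aut Γ → Aut Γ/≈
    Aut/≈ g = record
      { vertices = mk↔ₛ′ (π-Aut g) (π-Aut (≅-sym g)) g∘g⁻¹ g⁻¹∘g
      ; arcs     = λ {x} {y} → mk⇔ (π-Aut-hom g {x} {y})
          (λ e → subst₂ E/≈ (g⁻¹∘g x) (g⁻¹∘g y) (π-Aut-hom (≅-sym g) {π-Aut g x} {π-Aut g y} e))
      }
      where
      g∘g⁻¹ : ∀ x → π-Aut g (π-Aut (≅-sym g) x) ≡ x
      g∘g⁻¹ = π-Aut-inverse g (≅-sym g) (to∘from g)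
      g⁻¹∘g : ∀ x → π-Aut (≅-sym g) (π-Aut g x) ≡ x
      g⁻¹∘g = π-Aut-inverse (≅-sym g) g (from∘to g)

    -- After the initial representative, the lifted vertices are those stored in the successive
    -- arcs.
    lift : ∀ {k} → KArc Γ/≈ k → KArc Γ k
    lift α = record { vertex = vertex α ; arc = arc α }
      where
      vertex : ∀ {k} → KArc Γ/≈ k → Fin (suc k) → V
      vertex α fzero    = proj₁ (KArc.vertex α fzero)
      vertex α (fsuc i) = proj₁ (KArc.arc α i)
      arc : ∀ {k} (α : KArc Γ/≈ k) (i : Fin k) → E (vertex α (inject₁ i)) (vertex α (fsuc i))
      arc α fzero    = proj₁ (proj₂ (KArc.arc α fzero))
      arc α (fsuc i) with KArc.arc α (inject₁ i) | KArc.arc α (fsuc i)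
      -- The next stored vertex `w` is an out-neighbour of the representative of `z`, hence of `z`
      -- itself.
      ... | z , _ , rep≡ | w , zw , _ = Equivalence.from (≈-rep z w) (subst (λ x → E x w) (sym rep≡) zw)

    π-lift : ∀ {k} (α : KArc Γ/≈ k) i → π (KArc.vertex (lift α) i) ≡ KArc.vertex α i
    π-lift α fzero    = π-proj₁ _
    π-lift α (fsuc i) = V/≈-≡ (proj₂ (proj₂ (KArc.arc α i)))

    hat/≈ : HighlyArcTransitive Γ/≈
    hat/≈ k α β with hat k (lift α) (lift β)
    ... | g , g-lift = Aut/≈ g , λ i → begin
      π-Aut g (KArc.vertex α i)             ≡⟨ cong (π-Aut g) (π-lift α i) ⟨
      π-Aut g (π (KArc.vertex (lift α) i))  ≡⟨ π-Aut-π g _ ⟩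
      π (to g (KArc.vertex (lift α) i))     ≡⟨ cong π (g-lift i) ⟩
      π (KArc.vertex (lift β) i)            ≡⟨ π-lift β i ⟩
      KArc.vertex β i                       ∎
      where open ≡-Reasoning

    layered/≈ : Layered Γ/≈ p m/≈
    layered/≈ = record
      { connected = connected/≈
      ; hat       = hat/≈
      ; valency   = valency/≈
      ; φ         = φ/≈
      ; φ-hom     = λ {x} {y} → φ/≈-hom {x} {y}
      ; fibre     = fibre/≈
      }

  abstract
    reduce : m ≢ p → Σ (Digraph a (a ⊔ b)) λ Γ′ → ∃ λ m′ → Layered Γ′ p m′ × m ≡ m′ * p × Γ ≅ Pl Γ′
    reduce m≢p = Γ/≈ , m/≈ , layered/≈ , m≡size*p (+ 0) , ≅Pl
      where open Quotient (siblings-≈⇒≡ m≢p)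

-- Induction on the fibre size.

-- Each quotient divides `m` by `p > 1` and accounts for one application of `Pl`; the recursion ends
-- at `m ≡ p` with `r = 0`.
Layered⇒≅Pl^ : ∀ {a b} {Γ : Digraph a b} {p m} → Prime p → Acc _<_ m → m ≢ 0 → Layered Γ p m →
               ∃ λ r → p ^ suc r ≡ m × Γ ≅ Pl^ r (Δ p)
Layered⇒≅Pl^ {p = p} {m} p-prime (acc rec) m≢0 L with m ℕ.≟ p
... | yes m≡p = 0 , trans (ℕ.^-identityʳ p) (sym m≡p) , Structure.≅Δ L p-prime {{ℕ.≢-nonZero m≢0}} m≡p
... | no  m≢p with Structure.reduce L p-prime {{ℕ.≢-nonZero m≢0}} m≢p
...   | Γ′ , m′ , L′ , m≡m′*p , Γ≅PlΓ′ with Layered⇒≅Pl^ p-prime (rec m′<m) m′≢0 L′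
  where
  m′≢0 : m′ ≢ 0
  m′≢0 m′≡0 = m≢0 (trans m≡m′*p (cong (_* p) m′≡0))
  m′<m : m′ < m
  m′<m = subst (m′ <_) (sym m≡m′*p)
    (ℕ.m<m*n m′ p {{ℕ.≢-nonZero m′≢0}} (ℕ.nonTrivial⇒n>1 p {{prime⇒nonTrivial p-prime}}))
...     | r , p^r≡m′ , Γ′≅Pl^ =
  suc r , trans (cong (p *_) p^r≡m′) (trans (ℕ.*-comm p m′) (sym m≡m′*p)) , ≅-trans Γ≅PlΓ′ (Pl-cong Γ′≅Pl^)

corollary16 :
    ∀ {a b} (Γ : Digraph a b) (p : ℕ) →
    TwoEnded Γ → HighlyArcTransitive Γ →
    Prime p → OutValency Γ p →
    (φ : Digraph.V Γ → ℤ) → IsHomomorphism Γ ℤ⃗ φ → Surjective _≡_ _≡_ φ →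
    (m : ℕ) → (∀ i → Fibre φ i ↔ Fin m) → m > 2 →
    ∃ λ r → p ^ suc r ≡ m × Γ ≅ Pl^ r (Δ p)
corollary16 Γ p (connected , _) hat p-prime valency φ φ-hom _ m fibre m>2 =
  Layered⇒≅Pl^ p-prime (<-wellFounded m) (ℕ.m<n⇒n≢0 m>2) (record
    { connected = connected
    ; hat       = hat
    ; valency   = valency
    ; φ         = φ
    ; φ-hom     = φ-hom
    ; fibre     = fibre
    })
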